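{- Let $x$ be a computable generalized almost periodic sequence over a finite alphabet, and suppose there is a computable function $f\colon\mathbb{N}\to\mathbb{N}$ with $f(n)\geqslant r_x(n)$ for all $n$. Then the almost periodicity regulator $r_x$ is computable.
   Context: A sequence over a finite alphabet $A$ is a map $x\colon\mathbb{N}\to A$; $x[i,j]$ denotes the word $x(i)x(i+1)\dots x(j)$ and $x[i,\infty)$ the suffix starting at $i$. A word $u$ occurs in $x$ if $u=x[i,j]$ for some $i\le j$. The sequence $x$ is generalized almost periodic if for every word $u$ that occurs in $x$ infinitely many times there is $l\in\mathbb{N}$ such that every segment $x[i,i+l-1]$ of length $l$ contains an occurrence of $u$. For such $x$, the almost periodicity regulator $r_x\colon\mathbb{N}\to\mathbb{N}$ is defined by: $r_x(n)$ is the least $l$ such that every word of length $n$ occurring in $x$ infinitely often occurs in every segment of $x$ of length $l$, and every word of length $n$ occurring in $x$ only finitely often does not occur in $x[l,\infty)$. -}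

module Defs where

open import Data.Nat using (ℕ; _+_; _≤_)
open import Data.Fin using (Fin; toℕ)
open import Data.Vec using (Vec; lookup)
open import Data.Product using (Σ; _×_; ∃)
open import Relation.Nullary using (¬_)
open import Relation.Binary.PropositionalEquality using (_≡_)

Seq : ℕ → Set
Seq k = ℕ → Fin k

OccursAt : ∀ {k n} → Seq k → Vec (Fin k) n → ℕ → Set
OccursAt {n = n} x u i = ∀ (j : Fin n) → x (i + toℕ j) ≡ lookup u j

InfOften : ∀ {k n} → Seq k → Vec (Fin k) n → Set
InfOften x u = ∀ (N : ℕ) → Σ ℕ λ i → N ≤ i × OccursAt x u i

OccursInSegment : ∀ {k n} → Seq k → Vec (Fin k) n → ℕ → ℕ → Set
OccursInSegment {n = n} x u i l =
  Σ ℕ λ j → i ≤ j × (j + n ≤ i + l) × OccursAt x u j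

GenAlmostPeriodic : ∀ {k} → Seq k → Set
GenAlmostPeriodic {k} x =
  ∀ (n : ℕ) (u : Vec (Fin k) n) → InfOften x u →
  Σ ℕ λ l → ∀ (i : ℕ) → OccursInSegment x u i l

RegProp : ∀ {k} → Seq k → ℕ → ℕ → Set
RegProp {k} x n l =
  (∀ (u : Vec (Fin k) n) → InfOften x u → ∀ (i : ℕ) → OccursInSegment x u i l)
  × (∀ (u : Vec (Fin k) n) → ¬ InfOften x u → ∀ (i : ℕ) → l ≤ i → ¬ OccursAt x u i)

IsRegulator : ∀ {k} → Seq k → (ℕ → ℕ) → Set
IsRegulator x r = ∀ (n : ℕ) → RegProp x n (r n) × (∀ (l : ℕ) → RegProp x n l → r n ≤ l)

{-# OPTIONS --safe #-}
-- An upper bound f n ≥ r n makes RegProp x n l decidable, and r n is then the least l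
-- satisfying it, found by search below f n. Since f n satisfies RegProp, a word of length n
-- is recurrent iff it occurs at or after f n, iff it occurs in the window of length f n at
-- f n: a finite check, which also shows that every recurrent word of length n is the factor
-- of x at some position below 2 f n. Likewise every factor of length l at a position ≥ f l
-- reappears below 2 f l, so a recurrent word occurs in every window of length l iff it
-- occurs in those starting below 2 f l.
module Submission where

open import Defs
open import Data.Nat using (ℕ; suc; _+_; _≤_; _<_; _≤?_; _<?_; s≤s)
open import Data.Nat.Induction using (<-rec)
open import Data.Nat.Properties
  using (anyUpTo?; allUpTo?; ≮⇒≥; ≤-trans; <-≤-trans; m≤m+n; n≤1+n; m≤n⇒∃[o]m+o≡n;
         +-assoc; +-cancelˡ-≤; +-monoʳ-≤; +-monoʳ-<)
open import Data.Fin using (Fin; toℕ; fromℕ<; _≟_)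
open import Data.Fin.Properties using (toℕ-fromℕ<; toℕ<n; all?)
open import Data.Vec using (Vec; lookup; tabulate)
open import Data.Vec.Properties using (lookup∘tabulate; tabulate∘lookup; tabulate-cong)
open import Data.Product using (Σ; _×_; _,_; proj₁; proj₂)
import Data.Product as Product
open import Data.Empty using (⊥-elim)
open import Function using (_∘_)
open import Relation.Nullary using (Dec; yes; no; ¬_)
open import Relation.Nullary.Decidable using (map′; _×-dec_; _→-dec_)
open import Relation.Unary using (Pred; Decidable)
open import Relation.Binary.PropositionalEquality using (_≡_; refl; sym; trans; cong; subst; module ≡-Reasoning)

Minimum : ∀ {p} → Pred ℕ p → Set p
Minimum P = Σ ℕ λ r → P r × (∀ {l} → P l → r ≤ l)

minimum : ∀ {p} {P : Pred ℕ p} → Decidable P → ∀ {m} → P m → Minimum P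
minimum {P = P} P? {m} = <-rec (λ m → P m → Minimum P) step m
  where
  step : ∀ m → (∀ {n} → n < m → P n → Minimum P) → P m → Minimum P
  step m rec Pm with anyUpTo? P? m
  ... | yes (n , n<m , Pn) = rec n<m Pn
  ... | no ∄n<m = m , Pm , λ {l} Pl → ≮⇒≥ (λ l<m → ∄n<m (l , l<m , Pl))

module _ {k : ℕ} (x : Seq k) where

  Recurrent : ℕ → ℕ → Set
  Recurrent n l = ∀ (u : Vec (Fin k) n) → InfOften x u → ∀ i → OccursInSegment x u i l

  Transient : ℕ → ℕ → Set
  Transient n l = ∀ (u : Vec (Fin k) n) → ¬ InfOften x u → ∀ i → l ≤ i → ¬ OccursAt x u i

  factor : ℕ → (n : ℕ) → Vec (Fin k) n
  factor i n = tabulate (λ j → x (i + toℕ j))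

  factor-occursAt : ∀ i n → OccursAt x (factor i n) i
  factor-occursAt i n j = sym (lookup∘tabulate (λ j → x (i + toℕ j)) j)

  occursAt⇒≡factor : ∀ {n} (u : Vec (Fin k) n) {i} → OccursAt x u i → u ≡ factor i n
  occursAt⇒≡factor u o = trans (sym (tabulate∘lookup u)) (tabulate-cong (sym ∘ o))

  occursAt? : ∀ {n} (u : Vec (Fin k) n) i → Dec (OccursAt x u i)
  occursAt? u i = all? (λ j → x (i + toℕ j) ≟ lookup u j)

  occursInSegment? : ∀ {n} (u : Vec (Fin k) n) i l → Dec (OccursInSegment x u i l)
  occursInSegment? {n} u i l =
    map′ (λ (j , _ , s) → j , s)
         (λ (j , i≤j , j+n≤i+l , o) → j , s≤s (≤-trans (m≤m+n j n) j+n≤i+l) , i≤j , j+n≤i+l , o)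
         (anyUpTo? (λ j → i ≤? j ×-dec (j + n ≤? i + l ×-dec occursAt? u j)) (suc (i + l)))

  factor≡⇒agree : ∀ {p i l} → factor p l ≡ factor i l → ∀ {m} → m < l → x (p + m) ≡ x (i + m)
  factor≡⇒agree {p} {i} {l} eq {m} m<l = begin
    x (p + m)             ≡⟨ cong (λ t → x (p + t)) (sym (toℕ-fromℕ< m<l)) ⟩
    x (p + toℕ j)         ≡⟨ factor-occursAt p l j ⟩
    lookup (factor p l) j ≡⟨ cong (λ w → lookup w j) eq ⟩
    lookup (factor i l) j ≡⟨ sym (factor-occursAt i l j) ⟩
    x (i + toℕ j)         ≡⟨ cong (λ t → x (i + t)) (toℕ-fromℕ< m<l) ⟩
    x (i + m)             ∎
    where
    open ≡-Reasoning
    j = fromℕ< m<l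

  occursInSegment-shift : ∀ {n l p i} (v : Vec (Fin k) n) → factor p l ≡ factor i l →
    OccursInSegment x v p l → OccursInSegment x v i l
  occursInSegment-shift {n} {l} {p} {i} v eq (q , p≤q , q+n≤p+l , o)
    with m≤n⇒∃[o]m+o≡n p≤q
  ... | d , refl = i + d , m≤m+n i d , i+d+n≤i+l , o′
    where
    open ≡-Reasoning
    d+n≤l : d + n ≤ l
    d+n≤l = +-cancelˡ-≤ p (d + n) l (subst (_≤ p + l) (+-assoc p d n) q+n≤p+l)
    i+d+n≤i+l : i + d + n ≤ i + l
    i+d+n≤i+l = subst (_≤ i + l) (sym (+-assoc i d n)) (+-monoʳ-≤ i d+n≤l)
    o′ : OccursAt x v (i + d)
    o′ t = begin
      x (i + d + toℕ t)   ≡⟨ cong x (+-assoc i d (toℕ t)) ⟩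
      x (i + (d + toℕ t)) ≡⟨ sym (factor≡⇒agree eq (<-≤-trans (+-monoʳ-< d (toℕ<n t)) d+n≤l)) ⟩
      x (p + (d + toℕ t)) ≡⟨ cong x (sym (+-assoc p d (toℕ t))) ⟩
      x (p + d + toℕ t)   ≡⟨ o t ⟩
      lookup v t          ∎

  -- The second condition of RegProp only gives ¬ ¬ InfOften; the occurrence after N is
  -- found in the window at N + l, which the first condition forces to contain u.
  infOften-beyond : ∀ {n l p} → RegProp x n l → (u : Vec (Fin k) n) → l ≤ p → OccursAt x u p →
    InfOften x u
  infOften-beyond {n} {l} {p} (recurrent , transient) u l≤p o N
    with occursInSegment? u (N + l) l
  ... | yes (q , N+l≤q , _ , oq) = q , ≤-trans (m≤m+n N l) N+l≤q , oq
  ... | no ∄ = ⊥-elim (transient u (λ io → ∄ (recurrent u io (N + l))) p l≤p o)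

  factor-infOften : ∀ {n l i} → RegProp x n l → l ≤ i → InfOften x (factor i n)
  factor-infOften {n} {i = i} reg l≤i = infOften-beyond reg (factor i n) l≤i (factor-occursAt i n)

  infOften? : ∀ {n l} → RegProp x n l → (u : Vec (Fin k) n) → Dec (InfOften x u)
  infOften? {l = l} reg u with occursInSegment? u l l
  ... | yes (p , l≤p , _ , o) = yes (infOften-beyond reg u l≤p o)
  ... | no ∄ = no (λ io → ∄ (proj₁ reg u io l))

module _ {k : ℕ} (x : Seq k) {f : ℕ → ℕ} (f-reg : ∀ n → RegProp x n (f n)) where

  BoundedRecurrent : ℕ → ℕ → Set
  BoundedRecurrent n l =
    ∀ {j} → j < suc (f n + f n) → InfOften x (factor x j n) →
    ∀ {i} → i < suc (f l + f l) → OccursInSegment x (factor x j n) i l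

  BoundedTransient : ℕ → ℕ → Set
  BoundedTransient n l = ∀ {i} → i < f n → l ≤ i → InfOften x (factor x i n)

  -- A factor of length l beyond f l is recurrent, so it occurs in the window of length f l at f l.
  factor-reappears : ∀ {l i} → f l ≤ i → Σ ℕ λ p → p < suc (f l + f l) × factor x p l ≡ factor x i l
  factor-reappears {l} {i} fl≤i
    with proj₁ (f-reg l) (factor x i l) (factor-infOften x (f-reg l) fl≤i) (f l)
  ... | p , _ , p+l≤2fl , o =
    p , s≤s (≤-trans (m≤m+n p l) p+l≤2fl) , sym (occursAt⇒≡factor x (factor x i l) o)

  occursInSegment-everywhere : ∀ {n l} (v : Vec (Fin k) n) →
    (∀ {i} → i < suc (f l + f l) → OccursInSegment x v i l) → ∀ i → OccursInSegment x v i l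
  occursInSegment-everywhere {l = l} v early i with i <? suc (f l + f l)
  ... | yes i<2fl = early i<2fl
  ... | no i≮2fl with factor-reappears (≤-trans (m≤m+n (f l) (f l)) (≤-trans (n≤1+n _) (≮⇒≥ i≮2fl)))
  ...   | p , p<2fl , same = occursInSegment-shift x v same (early p<2fl)

  recurrent⇒bounded : ∀ {n l} → Recurrent x n l → BoundedRecurrent n l
  recurrent⇒bounded {n} recurrent {j} _ io _ = recurrent (factor x j n) io _

  bounded⇒recurrent : ∀ {n l} → BoundedRecurrent n l → Recurrent x n l
  bounded⇒recurrent {n} {l} bounded u io i with proj₁ (f-reg n) u io (f n)
  ... | j , _ , j+n≤2fn , o = subst (λ v → OccursInSegment x v i l) (sym u≡w) w-everywhere
    where
    u≡w : u ≡ factor x j n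
    u≡w = occursAt⇒≡factor x u o
    w-everywhere : OccursInSegment x (factor x j n) i l
    w-everywhere = occursInSegment-everywhere (factor x j n)
      (bounded (s≤s (≤-trans (m≤m+n j n) j+n≤2fn)) (subst (InfOften x) u≡w io)) i

  transient⇒bounded : ∀ {n l} → Transient x n l → BoundedTransient n l
  transient⇒bounded {n} transient {i} _ l≤i with infOften? x (f-reg n) (factor x i n)
  ... | yes io = io
  ... | no ¬io = ⊥-elim (transient (factor x i n) ¬io i l≤i (factor-occursAt x i n))

  bounded⇒transient : ∀ {n l} → BoundedTransient n l → Transient x n l
  bounded⇒transient {n} bounded u ¬io i l≤i o with i <? f n
  ... | yes i<fn = ¬io (subst (InfOften x) (sym (occursAt⇒≡factor x u o)) (bounded i<fn l≤i))
  ... | no i≮fn = proj₂ (f-reg n) u ¬io i (≮⇒≥ i≮fn) o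

  boundedRecurrent? : ∀ n l → Dec (BoundedRecurrent n l)
  boundedRecurrent? n l =
    allUpTo? (λ j → infOften? x (f-reg n) (factor x j n) →-dec
                    allUpTo? (λ i → occursInSegment? x (factor x j n) i l) _) _

  boundedTransient? : ∀ n l → Dec (BoundedTransient n l)
  boundedTransient? n l = allUpTo? (λ i → l ≤? i →-dec infOften? x (f-reg n) (factor x i n)) (f n)

  regProp? : ∀ n → Decidable (RegProp x n)
  regProp? n l =
    map′ (Product.map (bounded⇒recurrent {n} {l}) (bounded⇒transient {n} {l}))
         (Product.map (recurrent⇒bounded {n} {l}) (transient⇒bounded {n} {l}))
         (boundedRecurrent? n l ×-dec boundedTransient? n l)

proposition2 : ∀ {k : ℕ} (x : Seq k) → GenAlmostPeriodic x →
    (f : ℕ → ℕ) → (∀ (n : ℕ) → RegProp x n (f n)) →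
    Σ (ℕ → ℕ) λ r → IsRegulator x r
proposition2 x _ f f-reg =
  proj₁ ∘ least , λ n → proj₁ (proj₂ (least n)) , λ _ → proj₂ (proj₂ (least n))
  where
  least : ∀ n → Minimum (RegProp x n)
  least n = minimum (regProp? x f-reg n) (f-reg n)
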